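{- Let $f(x)\in\mathbf{Z}[x]$ be a nonconstant separable polynomial, and let $R(f)$ be the set of all primes $q$ that are good for $f(x)$ and such that $f(x)$ has a root modulo $q$. For any finite subset $T$ of $R(f)$ there exists $d\in\mathcal{S}(f)$ such that $d$ is divisible by every prime in $T$.
   Context: Squarefree integers may be negative and are nonzero. For a nonzero rational number $r$, its squarefree part $S(r)$ is the unique squarefree integer $d$ such that $r/d$ is a square in $\mathbf{Q}$. For a separable nonconstant $f(x)\in\mathbf{Z}[x]$, $\mathcal{S}(f)=\{S(f(r)) : r\in\mathbf{Q},\ f(r)\neq 0\}$. An odd prime $q$ is good for $f(x)$ if the reduced polynomial $\bar f(x)\in\mathbf{F}_q[x]$ has the same degree as $f(x)$ and has nonzero discriminant. -}

module Defs where

open import Algebra.Bundles using (CommutativeRing)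
import Algebra.Properties.Monoid.Mult as Mult
import Algebra.Properties.Monoid.Sum as Sum
import Algebra.Properties.Semiring.Exp as Exp
open import Algebra.Structures using (IsCommutativeRing)
open import Data.Fin.Base using (Fin; zero; suc; toℕ; opposite; punchIn; splitAt)
open import Data.Integer.Base as ℤ using (ℤ; +_; 0ℤ; 1ℤ; ∣_∣)
import Data.Integer.Divisibility.Signed as ℤ
import Data.Integer.Properties as ℤ
open import Data.Integer.Tactic.RingSolver using (solve-∀)
open import Data.List.Base using (List; []; _∷_; _++_; map; replicate)
open import Data.Nat.Base as ℕ using (ℕ; zero; suc; _∸_)
open import Data.Nat.DivMod using (_/_)
open import Data.Nat.Primality using (Prime)
open import Data.Product.Base using (∃-syntax; _×_; _,_)
open import Data.Rational.Base as ℚ using (ℚ; 0ℚ)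
import Data.Rational.Properties as ℚ
open import Data.Sum.Base using (_⊎_; inj₁; inj₂)
open import Level using (0ℓ)
open import Relation.Binary.PropositionalEquality using (_≡_; _≢_; refl; sym; subst)
open import Relation.Nullary.Negation using (¬_)

-- A polynomial is the list of its coefficients in ascending order;
-- trailing zeros are allowed, so polynomials are compared by _≋_.
module Polynomial {c ℓ} (R : CommutativeRing c ℓ) where

  open CommutativeRing R using (Carrier; _≈_; _+_; _*_; -_; 0#; 1#; semiring; +-monoid)
  open Mult +-monoid using () renaming (_×_ to _·_)
  open Sum +-monoid using (sum)
  open Exp semiring using (_^_)

  Poly : Set c
  Poly = List Carrier

  coeff : Poly → ℕ → Carrier
  coeff []      _       = 0#
  coeff (a ∷ _) zero    = a
  coeff (_ ∷ p) (suc n) = coeff p n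

  infix 4 _≋_
  _≋_ : Poly → Poly → Set ℓ
  p ≋ q = ∀ n → coeff p n ≈ coeff q n

  eval : Poly → Carrier → Carrier
  eval []      x = 0#
  eval (a ∷ p) x = a + x * eval p x

  infixl 6 _⊕_
  _⊕_ : Poly → Poly → Poly
  []      ⊕ q       = q
  (a ∷ p) ⊕ []      = a ∷ p
  (a ∷ p) ⊕ (b ∷ q) = a + b ∷ p ⊕ q

  infixl 7 _⊗_
  _⊗_ : Poly → Poly → Poly
  []      ⊗ q = []
  (a ∷ p) ⊗ q = map (a *_) q ⊕ (0# ∷ p ⊗ q)

  X^_⊗_ : ℕ → Poly → Poly
  X^ n ⊗ p = replicate n 0# ++ p

  -- Multiplies the successive coefficients by k, k + 1, k + 2, …
  scaleFrom : ℕ → Poly → Poly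
  scaleFrom k []      = []
  scaleFrom k (a ∷ p) = k · a ∷ scaleFrom (suc k) p

  derivative : Poly → Poly
  derivative []      = []
  derivative (_ ∷ p) = scaleFrom 1 p

  HasDegree : Poly → ℕ → Set ℓ
  HasDegree p n = ¬ (coeff p n ≈ 0#) × (∀ m → n ℕ.< m → coeff p m ≈ 0#)

  Nonconstant : Poly → Set ℓ
  Nonconstant p = ∃[ n ] HasDegree p n × 1 ℕ.≤ n

  -- Over a field: p is coprime to its derivative.
  Separable : Poly → Set _
  Separable p = ∃[ u ] ∃[ v ] u ⊗ p ⊕ v ⊗ derivative p ≋ 1# ∷ []

  -- Laplace expansion along the first row.
  det : ∀ {n} → (Fin n → Fin n → Carrier) → Carrier
  det {zero}  M = 1#
  det {suc n} M =
    sum λ j → (- 1#) ^ toℕ j * (M zero j * det λ i k → M (suc i) (punchIn j k))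

  sylvesterRow : ∀ {m n} → Poly → Poly → Fin n ⊎ Fin m → Poly
  sylvesterRow p q (inj₁ k) = X^ toℕ (opposite k) ⊗ p
  sylvesterRow p q (inj₂ k) = X^ toℕ (opposite k) ⊗ q

  -- Sylvester matrix of p and q, of formal degrees m and n: the rows are
  -- Xⁿ⁻¹p, …, p, Xᵐ⁻¹q, …, q, written in the basis Xᵐ⁺ⁿ⁻¹, …, X, 1.
  sylvester : ∀ m n → Poly → Poly → Fin (n ℕ.+ m) → Fin (n ℕ.+ m) → Carrier
  sylvester m n p q i j = coeff (sylvesterRow p q (splitAt n i)) (toℕ (opposite j))

  resultant : ℕ → ℕ → Poly → Poly → Carrier
  resultant m n p q = det (sylvester m n p q)

  -- disc p = (-1)^(n(n-1)/2) aₙ⁻¹ Res(p , p′) for p of degree n ≥ 1 with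
  -- leading coefficient aₙ; over an integral domain D is unique.  The
  -- derivative is taken in formal degree n - 1, even if the characteristic
  -- makes its actual degree smaller.
  IsDiscriminant : ℕ → Poly → Carrier → Set ℓ
  IsDiscriminant n p D =
    coeff p n * D ≈ (- 1#) ^ (n ℕ.* (n ∸ 1) / 2) * resultant n (n ∸ 1) p (derivative p)

  HasNonzeroDiscriminant : ℕ → Poly → Set _
  HasNonzeroDiscriminant n p = ∃[ D ] IsDiscriminant n p D × ¬ (D ≈ 0#)

infix 4 _≡_[mod_]
record _≡_[mod_] (x y : ℤ) (q : ℕ) : Set where
  constructor mod
  field
    divides-difference : + q ℤ.∣ x ℤ.- y

-- ℤ/qℤ as a setoid quotient of ℤ, so that reduction modulo q is the
-- identity on representatives.
ℤ/_ : ℕ → CommutativeRing 0ℓ 0ℓ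
ℤ/ q = record { isCommutativeRing = isCommutativeRing }
  where
  open import Data.Integer.Base using (_+_; _*_; -_; _-_)
  open import Data.Integer.Divisibility.Signed using (_∣_)

  _≈_ : ℤ → ℤ → Set
  x ≈ y = x ≡ y [mod q ]

  reflexive : ∀ {x y} → x ≡ y → x ≈ y
  reflexive {x} refl = mod (subst (+ q ∣_) (sym (ℤ.+-inverseʳ x)) (ℤ.divides 0ℤ refl))

  ≈-sym : ∀ {x y} → x ≈ y → y ≈ x
  ≈-sym {x} {y} (mod d) = mod (subst (+ q ∣_) (lemma x y) (ℤ.∣m⇒∣-m d))
    where
    lemma : ∀ x y → - (x - y) ≡ y - x
    lemma = solve-∀

  ≈-trans : ∀ {x y z} → x ≈ y → y ≈ z → x ≈ z
  ≈-trans {x} {y} {z} (mod d) (mod e) =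
    mod (subst (+ q ∣_) (lemma x y z) (ℤ.∣m∣n⇒∣m+n d e))
    where
    lemma : ∀ x y z → (x - y) + (y - z) ≡ x - z
    lemma = solve-∀

  +-cong : ∀ {x y u v} → x ≈ y → u ≈ v → (x + u) ≈ (y + v)
  +-cong {x} {y} {u} {v} (mod d) (mod e) =
    mod (subst (+ q ∣_) (lemma x y u v) (ℤ.∣m∣n⇒∣m+n d e))
    where
    lemma : ∀ x y u v → (x - y) + (u - v) ≡ (x + u) - (y + v)
    lemma = solve-∀

  *-cong : ∀ {x y u v} → x ≈ y → u ≈ v → (x * u) ≈ (y * v)
  *-cong {x} {y} {u} {v} (mod d) (mod e) =
    mod (subst (+ q ∣_) (lemma x y u v) (ℤ.∣m∣n⇒∣m+n (ℤ.∣m⇒∣m*n u d) (ℤ.∣n⇒∣m*n y e)))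
    where
    lemma : ∀ x y u v → (x - y) * u + y * (u - v) ≡ x * u - y * v
    lemma = solve-∀

  -‿cong : ∀ {x y} → x ≈ y → (- x) ≈ (- y)
  -‿cong {x} {y} (mod d) = mod (subst (+ q ∣_) (lemma x y) (ℤ.∣m⇒∣-m d))
    where
    lemma : ∀ x y → - (x - y) ≡ (- x) - (- y)
    lemma = solve-∀

  isCommutativeRing : IsCommutativeRing _≈_ _+_ _*_ -_ 0ℤ 1ℤ
  isCommutativeRing = record
    { isRing = record
      { +-isAbelianGroup = record
        { isGroup = record
          { isMonoid = record
            { isSemigroup = record
              { isMagma = record
                { isEquivalence = record
                  { refl = reflexive refl ; sym = ≈-sym ; trans = ≈-trans }
                ; ∙-cong = +-cong
                }
              ; assoc = λ x y z → reflexive (ℤ.+-assoc x y z)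
              }
            ; identity = (λ x → reflexive (ℤ.+-identityˡ x)) , (λ x → reflexive (ℤ.+-identityʳ x))
            }
          ; inverse = (λ x → reflexive (ℤ.+-inverseˡ x)) , (λ x → reflexive (ℤ.+-inverseʳ x))
          ; ⁻¹-cong = -‿cong
          }
        ; comm = λ x y → reflexive (ℤ.+-comm x y)
        }
      ; *-cong = *-cong
      ; *-assoc = λ x y z → reflexive (ℤ.*-assoc x y z)
      ; *-identity = (λ x → reflexive (ℤ.*-identityˡ x)) , (λ x → reflexive (ℤ.*-identityʳ x))
      ; distrib = (λ x y z → reflexive (ℤ.*-distribˡ-+ x y z))
                , (λ x y z → reflexive (ℤ.*-distribʳ-+ x y z))
      }
    ; *-comm = λ x y → reflexive (ℤ.*-comm x y)
    }

module ℤ[x] = Polynomial ℤ.+-*-commutativeRing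
module ℚ[x] = Polynomial ℚ.+-*-commutativeRing
module ℤ/_[x] (q : ℕ) = Polynomial (ℤ/ q)

fromℤ : ℤ → ℚ
fromℤ i = i ℚ./ 1

toℚ[x] : ℤ[x].Poly → ℚ[x].Poly
toℚ[x] = map fromℤ

reduce : ∀ q → ℤ[x].Poly → ℤ/_[x].Poly q
reduce q f = f

Squarefree : ℤ → Set
Squarefree d = d ≢ 0ℤ × (∀ m → m ℤ.* m ℤ.∣ d → ∣ m ∣ ≡ 1)

-- d = S(r), for r ≠ 0.
IsSquarefreePart : ℚ → ℤ → Set
IsSquarefreePart r d = Squarefree d × ∃[ s ] r ≡ fromℤ d ℚ.* (s ℚ.* s)

_⟨_⟩ : ℤ[x].Poly → ℚ → ℚ
f ⟨ r ⟩ = ℚ[x].eval (toℚ[x] f) r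

-- d ∈ 𝒮(f).
𝒮 : ℤ[x].Poly → ℤ → Set
𝒮 f d = ∃[ r ] f ⟨ r ⟩ ≢ 0ℚ × IsSquarefreePart (f ⟨ r ⟩) d

Good : ℤ[x].Poly → ℕ → Set
Good f q = Prime q × q ≢ 2 ×
  ∃[ n ] ℤ[x].HasDegree f n
       × ℤ/_[x].HasDegree q (reduce q f) n
       × ℤ/_[x].HasNonzeroDiscriminant q n (reduce q f)

HasRootMod : ℤ[x].Poly → ℕ → Set
HasRootMod f q = ∃[ a ] ℤ/_[x].eval q (reduce q f) a ≡ 0ℤ [mod q ]

-- q ∈ R(f).
R : ℤ[x].Poly → ℕ → Set
R f q = Good f q × HasRootMod f q

{-# OPTIONS --safe #-}

-- Let q ∈ R(f) and let a be a root of f modulo q.  If a were also a root of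
-- f′ modulo q, then every row of the Sylvester matrix of f and f′ would vanish
-- at a, and adding to each column a times the preceding one (Horner's scheme)
-- would produce a zero last column; so the nonzero discriminant makes a a
-- simple root.  Hence q divides f(a) or f(a + q) exactly once.  By the Chinese
-- remainder theorem modulo the squares q², some integer x has f(x) divisible
-- exactly once by every q ∈ T, and such a q must divide the squarefree part of
-- f(x).  Only for empty T does f(x) ≠ 0 need a separate argument.

module Submission where

open import Defs
open import Algebra.Bundles using (CommutativeRing)
import Algebra.Properties.CommutativeMonoid.Sum as CommutativeSum
import Algebra.Properties.Monoid.Mult as Mult
import Algebra.Properties.Ring as RingProperties
import Algebra.Properties.Semiring.Exp as Exp
import Algebra.Properties.Semiring.Sum as SemiringSum
import Algebra.Solver.Ring.NaturalCoefficients.Default as RingSolver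
open import Data.Fin.Base using (Fin; zero; suc; toℕ; fromℕ; fromℕ<; inject₁; opposite; punchIn; punchOut; splitAt)
import Data.Fin.Properties as Fin
open import Data.Integer.Base as ℤ using (ℤ; +_; 0ℤ; 1ℤ; ∣_∣)
open import Data.Integer.Divisibility.Signed using (_∣_; divides; ∣⇒∣ᵤ; ∣ᵤ⇒∣; 0∣⇒≡0; _∣?_; ∣-trans; ∣m∣n⇒∣m+n; ∣m+n∣m⇒∣n; ∣m⇒∣-m; ∣n⇒∣m*n; ∣m⇒∣m*n; *-cancelˡ-∣)
import Data.Integer.Properties as ℤ
open import Data.Integer.Tactic.RingSolver using (solve-∀)
open import Data.List.Base using (List; []; _∷_; drop)
open import Data.List.Relation.Unary.All as All using (All; []; _∷_)
open import Data.List.Relation.Unary.Any using (here; there)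
open import Data.Nat.Base as ℕ using (ℕ; zero; suc; _∸_; z≤n; s≤s)
open import Data.Nat.Coprimality using (Coprime; coprime-Bézout)
open import Data.Nat.DivMod using (_/_)
import Data.Nat.Divisibility as ℕ∣
open import Data.Nat.GCD using (module Bézout)
open import Data.Nat.Induction using (Acc; acc; <-wellFounded)
open import Data.Nat.Primality using (Prime; euclidsLemma; prime⇒irreducible; prime⇒nonZero; ¬prime[1])
import Data.Nat.Properties as ℕ
open import Data.List.Membership.DecPropositional ℕ._≟_ using (_∈_; _∈?_)
open import Data.Product.Base using (∃-syntax; _×_; _,_)
open import Data.Rational.Base as ℚ using (0ℚ)
import Data.Rational.Properties as ℚ
open import Data.Rational.Unnormalised.Base as ℚᵘ using (mkℚᵘ; *≡*)
import Data.Rational.Unnormalised.Properties as ℚᵘ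
open import Data.Sum.Base using (_⊎_; inj₁; inj₂; [_,_]′)
open import Data.Vec.Functional using (updateAt)
open import Data.Vec.Functional.Properties using (updateAt-updates; updateAt-minimal)
open import Function.Base using (_∘_; const)
open import Relation.Binary.PropositionalEquality as ≡ using (_≡_; _≢_)
import Relation.Binary.Reasoning.Setoid as SetoidReasoning
open import Relation.Nullary.Decidable.Core using (yes; no; _×-dec_)
open import Relation.Nullary.Negation using (¬_; contradiction)

-- Index maps on finite sets.

-- Lets the minors along all other columns inherit a pair of equal adjacent columns, so that
-- `det-adjacentColumns` can recurse.
punchIn-adjacent : ∀ {n} (j : Fin (suc (suc n))) (k : Fin (suc n)) → j ≢ inject₁ k → j ≢ suc k →
  ∃[ k′ ] punchIn j (inject₁ k′) ≡ inject₁ k × punchIn j (suc k′) ≡ suc k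
punchIn-adjacent zero          zero    j≢k _ = contradiction ≡.refl j≢k
punchIn-adjacent zero          (suc k) _   _ = k , ≡.refl , ≡.refl
punchIn-adjacent (suc zero)    zero    _ j≢1+k = contradiction ≡.refl j≢1+k
punchIn-adjacent {suc n} (suc (suc j)) zero _ _ = zero , ≡.refl , ≡.refl
punchIn-adjacent {suc n} (suc j) (suc k) j≢k j≢1+k
  with k′ , eq , eq′ ← punchIn-adjacent j k (j≢k ∘ ≡.cong suc) (j≢1+k ∘ ≡.cong suc)
  = suc k′ , ≡.cong suc eq , ≡.cong suc eq′

-- The two maps differ only at `c = k`, where each picks the column that the other deletes. Hence
-- deleting either of two equal adjacent columns gives the same minor.
punchIn-inject₁-suc : ∀ {n} (k c : Fin n) →
  punchIn (inject₁ k) c ≡ punchIn (suc k) c ⊎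
  (punchIn (inject₁ k) c ≡ suc k × punchIn (suc k) c ≡ inject₁ k)
punchIn-inject₁-suc zero    zero    = inj₂ (≡.refl , ≡.refl)
punchIn-inject₁-suc zero    (suc c) = inj₁ ≡.refl
punchIn-inject₁-suc (suc k) zero    = inj₁ ≡.refl
punchIn-inject₁-suc (suc k) (suc c) with punchIn-inject₁-suc k c
... | inj₁ eq        = inj₁ (≡.cong suc eq)
... | inj₂ (eq , eq′) = inj₂ (≡.cong suc eq , ≡.cong suc eq′)

opposite-fromℕ : ∀ n → toℕ (opposite (fromℕ n)) ≡ 0
opposite-fromℕ n = ≡.trans (Fin.opposite-prop (fromℕ n))
  (≡.trans (≡.cong (n ∸_) (Fin.toℕ-fromℕ n)) (ℕ.n∸n≡0 n))

opposite-inject₁ : ∀ {n} (k : Fin n) → toℕ (opposite (inject₁ k)) ≡ suc (toℕ (opposite k))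
opposite-inject₁ {suc n} zero    = ≡.refl
opposite-inject₁ {suc n} (suc k) = ≡.trans (Fin.toℕ-inject₁ (opposite (inject₁ k)))
  (≡.trans (opposite-inject₁ k) (≡.cong suc (≡.sym (Fin.toℕ-inject₁ (opposite k)))))

-- Interpolates between two rows of a matrix: raising `t` by one changes a single column, which
-- `det-linear` can handle.
splice : ∀ {a} {A : Set a} {n} → ℕ → (u v : Fin n → A) → Fin n → A
splice zero    u v         = v
splice (suc t) u v zero    = u zero
splice (suc t) u v (suc j) = splice t (u ∘ suc) (v ∘ suc) j

module _ {a} {A : Set a} where

  splice-before : ∀ {n} t (u v : Fin n → A) j → toℕ j ℕ.< t → splice t u v j ≡ u j
  splice-before (suc t) u v zero    _         = ≡.refl
  splice-before (suc t) u v (suc j) (s≤s j<t) = splice-before t (u ∘ suc) (v ∘ suc) j j<t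

  splice-after : ∀ {n} t (u v : Fin n → A) j → t ℕ.≤ toℕ j → splice t u v j ≡ v j
  splice-after zero    u v j       _         = ≡.refl
  splice-after (suc t) u v (suc j) (s≤s t≤j) = splice-after t (u ∘ suc) (v ∘ suc) j t≤j

  splice-suc : ∀ {n} (k : Fin n) (u v : Fin n → A) j → j ≢ k →
    splice (suc (toℕ k)) u v j ≡ splice (toℕ k) u v j
  splice-suc zero    u v zero    j≢k = contradiction ≡.refl j≢k
  splice-suc zero    u v (suc j) j≢k = ≡.refl
  splice-suc (suc k) u v zero    j≢k = ≡.refl
  splice-suc (suc k) u v (suc j) j≢k = splice-suc k (u ∘ suc) (v ∘ suc) j (j≢k ∘ ≡.cong suc)

-- Determinants under column operations.

module Determinant {c ℓ} (R : CommutativeRing c ℓ) where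

  open CommutativeRing R hiding (zero)
  open Polynomial R
  open CommutativeSum +-commutativeMonoid using (sum; sum-cong-≋; sum-replicate-zero; ∑-distrib-+)
  open SemiringSum semiring using (*-distribˡ-sum)
  open Exp semiring using (_^_)
  open RingProperties ring using (-1*x≈-x; +-identityʳ-unique)
  open Mult +-monoid using (×-congʳ) renaming (_×_ to _·_)
  open SetoidReasoning setoid
  open RingSolver commutativeSemiring using (solve; _:=_; _:+_; _:*_)

  Matrix : ℕ → Set c
  Matrix n = Fin n → Fin n → Carrier

  minor : ∀ {n} → Matrix (suc n) → Fin (suc n) → Matrix n
  minor M j i k = M (suc i) (punchIn j k)

  det-cong : ∀ {n} {M N : Matrix n} → (∀ i j → M i j ≈ N i j) → det M ≈ det N
  det-cong {zero}  M≈N = refl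
  det-cong {suc n} M≈N = sum-cong-≋ λ j →
    *-congˡ {(- 1#) ^ toℕ j} (*-cong (M≈N zero j) (det-cong λ i k → M≈N (suc i) (punchIn j k)))

  -- In the first-row expansion the term at `k` is linear through its entry, the minors being equal;
  -- every other term is linear through its minor, by induction, where column `k` survives as
  -- `punchOut j≢k`.
  det-linear : ∀ {n} (k : Fin n) a {L M N : Matrix n} →
    (∀ i j → j ≢ k → L i j ≈ M i j) → (∀ i j → j ≢ k → L i j ≈ N i j) →
    (∀ i → L i k ≈ M i k + a * N i k) → det L ≈ det M + a * det N
  det-linear {suc n} k a {L} {M} {N} L≈M L≈N Lk = begin
    sum (term L)                              ≈⟨ sum-cong-≋ term-linear ⟩
    sum (λ j → term M j + a * term N j)       ≈⟨ ∑-distrib-+ (term M) (λ j → a * term N j) ⟩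
    sum (term M) + sum (λ j → a * term N j)   ≈⟨ +-congˡ (*-distribˡ-sum a (term N)) ⟨
    sum (term M) + a * sum (term N)           ∎
    where
    term : Matrix (suc n) → Fin (suc n) → Carrier
    term P j = (- 1#) ^ toℕ j * (P zero j * det (minor P j))

    term-linear : ∀ j → term L j ≈ term M j + a * term N j
    term-linear j with j Fin.≟ k
    ... | yes ≡.refl = begin
      s * (L zero j * det (minor L j))
        ≈⟨ *-congˡ (*-congʳ (Lk zero)) ⟩
      s * ((M zero j + a * N zero j) * det (minor L j))
        ≈⟨ solve 5 (λ s a m n d → s :* ((m :+ a :* n) :* d) := s :* (m :* d) :+ a :* (s :* (n :* d)))
             refl s a (M zero j) (N zero j) (det (minor L j)) ⟩
      s * (M zero j * det (minor L j)) + a * (s * (N zero j * det (minor L j)))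
        ≈⟨ +-cong (*-congˡ (*-congˡ (det-cong λ i k → L≈M (suc i) (punchIn j k) (Fin.punchInᵢ≢i j k))))
                  (*-congˡ (*-congˡ (*-congˡ (det-cong λ i k → L≈N (suc i) (punchIn j k) (Fin.punchInᵢ≢i j k))))) ⟩
      term M j + a * term N j ∎
      where s = (- 1#) ^ toℕ j
    ... | no j≢k = begin
      s * (L zero j * det (minor L j))
        ≈⟨ *-congˡ (*-congˡ (det-linear k′ a (λ i l l≢k′ → L≈M (suc i) _ (avoid l l≢k′))
             (λ i l l≢k′ → L≈N (suc i) _ (avoid l l≢k′))
             λ i → ≡.subst (λ x → L (suc i) x ≈ M (suc i) x + a * N (suc i) x) (≡.sym j[k′]≡k) (Lk (suc i)))) ⟩
      s * (L zero j * (det (minor M j) + a * det (minor N j)))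
        ≈⟨ solve 5 (λ s a m d e → s :* (m :* (d :+ a :* e)) := s :* (m :* d) :+ a :* (s :* (m :* e)))
             refl s a (L zero j) (det (minor M j)) (det (minor N j)) ⟩
      s * (L zero j * det (minor M j)) + a * (s * (L zero j * det (minor N j)))
        ≈⟨ +-cong (*-congˡ (*-congʳ (L≈M zero j j≢k))) (*-congˡ (*-congˡ (*-congʳ (L≈N zero j j≢k)))) ⟩
      term M j + a * term N j ∎
      where
      s = (- 1#) ^ toℕ j
      k′ = punchOut j≢k
      j[k′]≡k : punchIn j k′ ≡ k
      j[k′]≡k = Fin.punchIn-punchOut j≢k
      avoid : ∀ l → l ≢ k′ → punchIn j l ≢ k
      avoid l l≢k′ eq = l≢k′ (Fin.punchIn-injective j l k′ (≡.trans eq (≡.sym j[k′]≡k)))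

  -- A zero column equals itself plus itself, so linearity gives `det M ≈ det M + 1# * det M`, and
  -- cancellation finishes.
  det-zeroColumn : ∀ {n} (k : Fin n) {M : Matrix n} → (∀ i → M i k ≈ 0#) → det M ≈ 0#
  det-zeroColumn k {M} Mk≈0 = begin
    det M       ≈⟨ *-identityˡ (det M) ⟨
    1# * det M  ≈⟨ +-identityʳ-unique (det M) (1# * det M) (sym (det-linear k 1# (λ _ _ _ → refl) (λ _ _ _ → refl) double)) ⟩
    0#          ∎
    where
    double : ∀ i → M i k ≈ M i k + 1# * M i k
    double i = sym (trans (+-congˡ (trans (*-congˡ (Mk≈0 i)) (zeroʳ 1#))) (+-identityʳ (M i k)))

  sum-zero : ∀ {n} (t : Fin n → Carrier) → (∀ j → t j ≈ 0#) → sum t ≈ 0#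
  sum-zero {n} t t≈0 = trans (sum-cong-≋ t≈0) (sum-replicate-zero n)

  sum-adjacent : ∀ {n} (k : Fin n) (t : Fin (suc n) → Carrier) →
    t (inject₁ k) + t (suc k) ≈ 0# →
    (∀ j → j ≢ inject₁ k → j ≢ suc k → t j ≈ 0#) → sum t ≈ 0#
  sum-adjacent {suc n} zero t pair rest = begin
    t zero + (t (suc zero) + sum (λ j → t (suc (suc j))))  ≈⟨ +-assoc _ _ _ ⟨
    t zero + t (suc zero) + sum (λ j → t (suc (suc j)))
      ≈⟨ +-cong pair (sum-zero _ λ j → rest (suc (suc j)) (λ ()) (λ ())) ⟩
    0# + 0#  ≈⟨ +-identityˡ 0# ⟩
    0# ∎
  sum-adjacent {suc n} (suc k) t pair rest = begin
    t zero + sum (t ∘ suc)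
      ≈⟨ +-cong (rest zero (λ ()) (λ ())) (sum-adjacent k (t ∘ suc) pair
           λ j j≢k j≢1+k → rest (suc j) (j≢k ∘ Fin.suc-injective) (j≢1+k ∘ Fin.suc-injective)) ⟩
    0# + 0#  ≈⟨ +-identityˡ 0# ⟩
    0# ∎

  -- The terms at the two equal columns have the same entry and the same minor but opposite signs;
  -- every other minor again has two equal adjacent columns.
  det-adjacentColumns : ∀ {n} (k : Fin n) {M : Matrix (suc n)} →
    (∀ i → M i (inject₁ k) ≈ M i (suc k)) → det M ≈ 0#
  det-adjacentColumns {suc n} k {M} equal = sum-adjacent k _ pair rest
    where
    s = (- 1#) ^ toℕ k
    m = M zero (suc k)
    d = det (minor M (suc k))

    minors : ∀ i c → minor M (inject₁ k) i c ≈ minor M (suc k) i c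
    minors i c with punchIn-inject₁-suc k c
    ... | inj₁ eq         = reflexive (≡.cong (M (suc i)) eq)
    ... | inj₂ (eq , eq′) = begin
      M (suc i) (punchIn (inject₁ k) c)  ≡⟨ ≡.cong (M (suc i)) eq ⟩
      M (suc i) (suc k)                  ≈⟨ equal (suc i) ⟨
      M (suc i) (inject₁ k)              ≡⟨ ≡.cong (M (suc i)) eq′ ⟨
      M (suc i) (punchIn (suc k) c)      ∎

    pair : (- 1#) ^ toℕ (inject₁ k) * (M zero (inject₁ k) * det (minor M (inject₁ k)))
         + (- 1#) * s * (m * d) ≈ 0#
    pair = begin
      (- 1#) ^ toℕ (inject₁ k) * (M zero (inject₁ k) * det (minor M (inject₁ k))) + (- 1#) * s * (m * d)
        ≈⟨ +-cong (*-cong (reflexive (≡.cong ((- 1#) ^_) (Fin.toℕ-inject₁ k)))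
                          (*-cong (equal zero) (det-cong minors)))
                  (trans (*-assoc _ _ _) (-1*x≈-x _)) ⟩
      s * (m * d) + - (s * (m * d))  ≈⟨ -‿inverseʳ _ ⟩
      0# ∎

    rest : ∀ j → j ≢ inject₁ k → j ≢ suc k → (- 1#) ^ toℕ j * (M zero j * det (minor M j)) ≈ 0#
    rest j j≢k j≢1+k with k′ , eq , eq′ ← punchIn-adjacent j k j≢k j≢1+k = begin
      (- 1#) ^ toℕ j * (M zero j * det (minor M j))
        ≈⟨ *-congˡ (*-congˡ (det-adjacentColumns k′ {minor M j} λ i → begin
             M (suc i) (punchIn j (inject₁ k′))  ≡⟨ ≡.cong (M (suc i)) eq ⟩
             M (suc i) (inject₁ k)               ≈⟨ equal (suc i) ⟩
             M (suc i) (suc k)                   ≡⟨ ≡.cong (M (suc i)) eq′ ⟨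
             M (suc i) (punchIn j (suc k′))      ∎)) ⟩
      (- 1#) ^ toℕ j * (M zero j * 0#)  ≈⟨ *-congˡ (zeroʳ _) ⟩
      (- 1#) ^ toℕ j * 0#               ≈⟨ zeroʳ _ ⟩
      0# ∎

  -- The columns of H arise from those of M by adding to each column a times
  -- the new column on its left, which leaves the determinant unchanged.
  det-horner : ∀ {n} a {M H : Matrix (suc n)} → (∀ i → H i zero ≈ M i zero) →
    (∀ i k → H i (suc k) ≈ M i (suc k) + a * H i (inject₁ k)) →
    (∀ i → H i (fromℕ n) ≈ 0#) → det M ≈ 0#
  det-horner {n} a {M} {H} first next last = begin
    det M            ≈⟨ det-stage n ℕ.≤-refl ⟨
    det (stage (suc n))
      ≈⟨ det-zeroColumn (fromℕ n) {stage (suc n)} (λ i → trans (reflexive (splice-before (suc n) (H i) (M i) (fromℕ n)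
           (ℕ.s≤s (ℕ.≤-reflexive (Fin.toℕ-fromℕ n))))) (last i)) ⟩
    0#               ∎
    where
    stage : ℕ → Matrix (suc n)
    stage t i = splice t (H i) (M i)

    step : ∀ k → det (stage (suc (suc (toℕ k)))) ≈ det (stage (suc (toℕ k)))
    step k = begin
      det L              ≈⟨ det-linear (suc k) a L≈K L≈N L[1+k] ⟩
      det K + a * det N  ≈⟨ +-congˡ (*-congˡ (det-adjacentColumns k {N} λ i →
                              trans (N[k] i) (sym (N[1+k] i)))) ⟩
      det K + a * 0#     ≈⟨ +-congˡ (zeroʳ a) ⟩
      det K + 0#         ≈⟨ +-identityʳ (det K) ⟩
      det K              ∎
      where
      K = stage (suc (toℕ k))
      L = stage (suc (suc (toℕ k)))

      -- Column `k + 1` of `K` is overwritten by its left neighbour, already in Horner form. The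
      -- step from `K` to `L` adds `a` times this column, and `N` has two equal adjacent columns.
      N : Matrix (suc n)
      N i = updateAt (K i) (suc k) (const (K i (inject₁ k)))

      L≈K : ∀ i j → j ≢ suc k → L i j ≈ K i j
      L≈K i j j≢ = reflexive (splice-suc (suc k) (H i) (M i) j j≢)

      L≈N : ∀ i j → j ≢ suc k → L i j ≈ N i j
      L≈N i j j≢ = trans (L≈K i j j≢) (reflexive (≡.sym (updateAt-minimal j (suc k) (K i) j≢)))

      N[1+k] : ∀ i → N i (suc k) ≈ K i (inject₁ k)
      N[1+k] i = reflexive (updateAt-updates (suc k) (K i))

      N[k] : ∀ i → N i (inject₁ k) ≈ K i (inject₁ k)
      N[k] i = reflexive (updateAt-minimal (inject₁ k) (suc k) (K i)
        λ eq → ℕ.1+n≢n (≡.sym (≡.trans (≡.sym (Fin.toℕ-inject₁ k)) (≡.cong toℕ eq))))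

      L[1+k] : ∀ i → L i (suc k) ≈ K i (suc k) + a * N i (suc k)
      L[1+k] i = begin
        L i (suc k)
          ≡⟨ splice-before _ (H i) (M i) (suc k) ℕ.≤-refl ⟩
        H i (suc k)
          ≈⟨ next i k ⟩
        M i (suc k) + a * H i (inject₁ k)
          ≡⟨ ≡.cong₂ (λ x y → x + a * y) (splice-after _ (H i) (M i) (suc k) ℕ.≤-refl)
               (splice-before _ (H i) (M i) (inject₁ k) (s≤s (ℕ.≤-reflexive (Fin.toℕ-inject₁ k)))) ⟨
        K i (suc k) + a * K i (inject₁ k)
          ≈⟨ +-congˡ (*-congˡ (N[1+k] i)) ⟨
        K i (suc k) + a * N i (suc k) ∎

    det-stage : ∀ t → t ℕ.≤ n → det (stage (suc t)) ≈ det M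
    -- The induction starts at stage 1: column 0 has no left neighbour and agrees in `H` and `M`.
    det-stage zero    _   = det-cong {M = stage 1} {M} λ where
      i zero    → first i
      i (suc j) → refl
    det-stage (suc t) t<n = trans
      (≡.subst (λ t → det (stage (suc (suc t))) ≈ det (stage (suc t))) (Fin.toℕ-fromℕ< t<n) (step (fromℕ< t<n)))
      (det-stage t (ℕ.<⇒≤ t<n))

  -- Horner's scheme, Sylvester matrices and common roots.

  -- One step of Horner's scheme, `drop e p` being the quotient of `p` by the `e`-th power of X.
  -- Past the end of the list both sides are zero.
  eval-drop : ∀ p e a → eval (drop e p) a ≈ coeff p e + a * eval (drop (suc e) p) a
  eval-drop []      zero    a = sym (trans (+-identityˡ _) (zeroʳ a))
  eval-drop []      (suc e) a = sym (trans (+-identityˡ _) (zeroʳ a))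
  eval-drop (x ∷ p) zero    a = refl
  eval-drop (x ∷ p) (suc e) a = eval-drop p e a

  -- Trailing zeros are allowed, so a degree bound does not make `drop b p` empty; it only makes its
  -- entries vanish.
  eval-drop≈0 : ∀ p b a → (∀ e → b ℕ.≤ e → coeff p e ≈ 0#) → eval (drop b p) a ≈ 0#
  eval-drop≈0 []      zero    a _  = refl
  eval-drop≈0 []      (suc b) a _  = refl
  eval-drop≈0 (x ∷ p) (suc b) a p≈0 = eval-drop≈0 p b a λ e b≤e → p≈0 (suc e) (s≤s b≤e)
  eval-drop≈0 (x ∷ p) zero    a p≈0 = begin
    x + a * eval p a  ≈⟨ +-cong (p≈0 0 z≤n) (*-congˡ (eval-drop≈0 p 0 a λ e _ → p≈0 (suc e) z≤n)) ⟩
    0# + a * 0#       ≈⟨ trans (+-identityˡ _) (zeroʳ a) ⟩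
    0#                ∎

  -- The Horner columns `H` begin with the top coefficients and end with the values `eval (p i) a`,
  -- which are zero. The size must be positive because the empty determinant is `1#`.
  det-commonRoot : ∀ {N} → 1 ℕ.≤ N → (p : Fin N → Poly) →
    (∀ i e → N ℕ.≤ e → coeff (p i) e ≈ 0#) →
    ∀ a → (∀ i → eval (p i) a ≈ 0#) → det (λ i j → coeff (p i) (toℕ (opposite j))) ≈ 0#
  det-commonRoot {suc n} _ p p≈0 a root = det-horner a {λ i j → coeff (p i) (toℕ (opposite j))} {H} first next last
    where
    H : Matrix (suc n)
    H i j = eval (drop (toℕ (opposite j)) (p i)) a

    first : ∀ i → H i zero ≈ coeff (p i) (toℕ (fromℕ n))
    first i rewrite Fin.toℕ-fromℕ n = begin
      eval (drop n (p i)) a                              ≈⟨ eval-drop (p i) n a ⟩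
      coeff (p i) n + a * eval (drop (suc n) (p i)) a    ≈⟨ +-congˡ (*-congˡ (eval-drop≈0 (p i) (suc n) a (p≈0 i))) ⟩
      coeff (p i) n + a * 0#                             ≈⟨ +-congˡ (zeroʳ a) ⟩
      coeff (p i) n + 0#                                 ≈⟨ +-identityʳ _ ⟩
      coeff (p i) n                                      ∎

    next : ∀ i k → H i (suc k) ≈ coeff (p i) (toℕ (opposite (suc k))) + a * H i (inject₁ k)
    next i k rewrite opposite-inject₁ k | Fin.toℕ-inject₁ (opposite k) = eval-drop (p i) (toℕ (opposite k)) a

    last : ∀ i → H i (fromℕ n) ≈ 0#
    last i rewrite opposite-fromℕ n = root i

  coeff-shift : ∀ s {p b} → (∀ e → b ℕ.≤ e → coeff p e ≈ 0#) →
    ∀ e → s ℕ.+ b ℕ.≤ e → coeff (X^ s ⊗ p) e ≈ 0#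
  coeff-shift zero    p≈0 e       b≤e       = p≈0 e b≤e
  coeff-shift (suc s) p≈0 (suc e) (s≤s b≤e) = coeff-shift s p≈0 e b≤e

  eval-shift : ∀ s {p} a → eval p a ≈ 0# → eval (X^ s ⊗ p) a ≈ 0#
  eval-shift zero    a root = root
  eval-shift (suc s) a root =
    trans (+-identityˡ _) (trans (*-congˡ (eval-shift s a root)) (zeroʳ a))

  -- Every Sylvester row is a power of X times `p` or `q`, so it vanishes at `a` and has degree
  -- below `n + m`. Only upper bounds on the degrees are assumed, because modulo a prime the
  -- derivative may fall below its formal degree.
  resultant-commonRoot : ∀ {m n} → 1 ℕ.≤ n ℕ.+ m → ∀ p q →
    (∀ e → m ℕ.< e → coeff p e ≈ 0#) → (∀ e → n ℕ.< e → coeff q e ≈ 0#) →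
    ∀ a → eval p a ≈ 0# → eval q a ≈ 0# → resultant m n p q ≈ 0#
  resultant-commonRoot {m} {n} 1≤n+m p q p≈0 q≈0 a pa≈0 qa≈0 =
    det-commonRoot 1≤n+m (λ i → sylvesterRow p q (splitAt n i))
      (λ i → degree (splitAt n i)) a (λ i → root (splitAt n i))
    where
    -- A shift is at most `u - 1` and coefficients vanish from `v + 1` on, so nothing is left from
    -- `u + v` on.
    shift≤ : ∀ {u} v (k : Fin u) → toℕ (opposite k) ℕ.+ suc v ℕ.≤ u ℕ.+ v
    shift≤ {u} v k = ≡.subst (ℕ._≤ u ℕ.+ v) (≡.sym (ℕ.+-suc (toℕ (opposite k)) v))
      (ℕ.+-monoˡ-≤ v (Fin.toℕ<n (opposite k)))

    degree : ∀ r e → n ℕ.+ m ℕ.≤ e → coeff (sylvesterRow {m} p q r) e ≈ 0#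
    degree (inj₁ k) e N≤e = coeff-shift (toℕ (opposite k)) p≈0 e (ℕ.≤-trans (shift≤ m k) N≤e)
    degree (inj₂ k) e N≤e = coeff-shift (toℕ (opposite k)) q≈0 e
      (ℕ.≤-trans (shift≤ n k) (ℕ.≤-trans (ℕ.≤-reflexive (ℕ.+-comm m n)) N≤e))

    root : ∀ r → eval (sylvesterRow {m} p q r) a ≈ 0#
    root (inj₁ k) = eval-shift (toℕ (opposite k)) a pa≈0
    root (inj₂ k) = eval-shift (toℕ (opposite k)) a qa≈0

  coeff-scaleFrom : ∀ k p e → coeff p e ≈ 0# → coeff (scaleFrom k p) e ≈ 0#
  coeff-scaleFrom k []      e       _   = refl
  coeff-scaleFrom k (x ∷ p) zero    x≈0 = trans (×-congʳ k x≈0) (×-zero k)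
    where
    ×-zero : ∀ k → k · 0# ≈ 0#
    ×-zero zero    = refl
    ×-zero (suc k) = trans (+-identityˡ _) (×-zero k)
  coeff-scaleFrom k (_ ∷ p) (suc e) p≈0 = coeff-scaleFrom (suc k) p e p≈0

  coeff-derivative : ∀ p e → coeff p (suc e) ≈ 0# → coeff (derivative p) e ≈ 0#
  coeff-derivative []      e _   = refl
  coeff-derivative (_ ∷ p) e p≈0 = coeff-scaleFrom 1 p e p≈0

-- Reduction modulo q and simplicity of roots.

open ≡ using (refl; sym; trans; cong; cong₂; subst; module ≡-Reasoning)
open ℤ[x] using (Poly; eval; derivative; scaleFrom; coeff)

module _ (q : ℕ) where

  open CommutativeRing (ℤ/ q) using (+-monoid)
  open CommutativeRing ℤ.+-*-commutativeRing using () renaming (+-monoid to ℤ-+-monoid)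

  -- `ℤ/ q` keeps the integers and their operations, so the values agree exactly, not merely modulo
  -- `q`. The two instances of `eval` are still distinct recursive functions, identified by
  -- induction.
  eval-mod : ∀ p x → ℤ/_[x].eval q p x ≡ eval p x
  eval-mod []      x = refl
  eval-mod (a ∷ p) x = cong (λ y → a ℤ.+ x ℤ.* y) (eval-mod p x)

  ×-mod : ∀ k a → Mult._×_ +-monoid k a ≡ Mult._×_ ℤ-+-monoid k a
  ×-mod zero    a = refl
  ×-mod (suc k) a = cong (λ y → a ℤ.+ y) (×-mod k a)

  scaleFrom-mod : ∀ k p → ℤ/_[x].scaleFrom q k p ≡ scaleFrom k p
  scaleFrom-mod k []      = refl
  scaleFrom-mod k (a ∷ p) = cong₂ _∷_ (×-mod k a) (scaleFrom-mod (suc k) p)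

  derivative-mod : ∀ p → ℤ/_[x].derivative q p ≡ derivative p
  derivative-mod []      = refl
  derivative-mod (_ ∷ p) = scaleFrom-mod 1 p

  ∣⇒≈0 : ∀ {x} → + q ∣ x → x ≡ 0ℤ [mod q ]
  ∣⇒≈0 {x} q∣x = mod (subst (+ q ∣_) (sym (ℤ.+-identityʳ x)) q∣x)

  ≈0⇒∣ : ∀ {x} → x ≡ 0ℤ [mod q ] → + q ∣ x
  ≈0⇒∣ {x} (mod q∣x-0) = subst (+ q ∣_) (ℤ.+-identityʳ x) q∣x-0

prime-∣-* : ∀ {q} → Prime q → ∀ x y → + q ∣ x ℤ.* y → (+ q ∣ x) ⊎ (+ q ∣ y)
prime-∣-* {q} pq x y q∣xy with euclidsLemma ∣ x ∣ ∣ y ∣ pq (subst (q ℕ∣.∣_) (ℤ.abs-* x y) (∣⇒∣ᵤ q∣xy))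
... | inj₁ q∣x = inj₁ (∣ᵤ⇒∣ q∣x)
... | inj₂ q∣y = inj₂ (∣ᵤ⇒∣ q∣y)

-- At a common root the resultant vanishes modulo `q`, and with it the product of the leading
-- coefficient and `D`. The prime `q` would divide one of the two, which goodness forbids.
root-simple : ∀ f {q a} → ℤ[x].Nonconstant f → Good f q → + q ∣ eval f a →
  ¬ (+ q ∣ eval (derivative f) a)
-- `Good` records the degree of `f` over the integers; degree 0 conflicts with the nonzero
-- coefficient of positive index in `Nonconstant`.
root-simple f (n , (lead≢0 , _) , 1≤n) (_ , _ , zero , (_ , deg) , _) _ _ = lead≢0 (deg n 1≤n)
root-simple f {q} {a} _ (q-prime , _ , suc n , _ , (lead≉0 , deg) , D , disc , D≉0) q∣fa q∣f′a
  = [ (λ q∣lead → lead≉0 (∣⇒≈0 q q∣lead)) , (λ q∣D → D≉0 (∣⇒≈0 q q∣D)) ]′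
      (prime-∣-* q-prime (ℤ/_[x].coeff q f (suc n)) D (≈0⇒∣ q lead*D≈0))
  where
  module F = CommutativeRing (ℤ/ q)
  open Determinant (ℤ/ q) using (resultant-commonRoot; coeff-derivative)

  f′ = ℤ/_[x].derivative q f
  sign = Exp._^_ F.semiring (ℤ.- 1ℤ) (suc n ℕ.* n / 2)

  resultant≈0 : ℤ/_[x].resultant q (suc n) n f f′ F.≈ 0ℤ
  resultant≈0 = resultant-commonRoot {suc n} {n} (subst (1 ℕ.≤_) (sym (ℕ.+-suc n n)) (s≤s z≤n))
    f f′ deg (λ e n<e → coeff-derivative f e (deg (suc e) (s≤s n<e))) a
    (F.trans (F.reflexive (eval-mod q f a)) (∣⇒≈0 q q∣fa))
    (F.trans (F.reflexive (trans (cong (λ p → ℤ/_[x].eval q p a) (derivative-mod q f)) (eval-mod q (derivative f) a)))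
      (∣⇒≈0 q q∣f′a))

  lead*D≈0 : ℤ/_[x].coeff q f (suc n) ℤ.* D F.≈ 0ℤ
  lead*D≈0 = F.trans disc (F.trans (F.*-congˡ {sign} resultant≈0) (F.zeroʳ sign))

-- Taylor expansion and congruences between values.

-- Raising the first multiplier by one adds each coefficient once more. For `k = 0` this yields the
-- product rule for a + Xp, as `scaleFrom 0 p` is X times the derivative.
eval-scaleFrom-suc : ∀ k p x → eval (scaleFrom (suc k) p) x ≡ eval p x ℤ.+ eval (scaleFrom k p) x
eval-scaleFrom-suc k []      x = refl
eval-scaleFrom-suc k (a ∷ p) x = trans
  (cong (λ y → suc k · a ℤ.+ x ℤ.* y) (eval-scaleFrom-suc (suc k) p x))
  (rearrange a (k · a) x (eval p x) (eval (scaleFrom (suc k) p) x))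
  where
  open Mult (CommutativeRing.+-monoid ℤ.+-*-commutativeRing) using () renaming (_×_ to _·_)
  rearrange : ∀ a b x u v → (a ℤ.+ b) ℤ.+ x ℤ.* (u ℤ.+ v) ≡ (a ℤ.+ x ℤ.* u) ℤ.+ (b ℤ.+ x ℤ.* v)
  rearrange = solve-∀

eval-derivative-∷ : ∀ a p x →
  eval (derivative (a ∷ p)) x ≡ eval p x ℤ.+ x ℤ.* eval (derivative p) x
eval-derivative-∷ a p x = trans (eval-scaleFrom-suc 0 p x) (cong (λ y → eval p x ℤ.+ y) (scaleFrom0 p))
  where
  scaleFrom0 : ∀ p → eval (scaleFrom 0 p) x ≡ x ℤ.* eval (derivative p) x
  scaleFrom0 []      = sym (ℤ.*-zeroʳ x)
  scaleFrom0 (_ ∷ p) = ℤ.+-identityˡ _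

-- An integral `k` avoids the factorial denominators of higher derivatives and makes the formula
-- usable modulo `h * h`.
taylor : ∀ p x h → ∃[ k ] eval p (x ℤ.+ h) ≡
  eval p x ℤ.+ h ℤ.* eval (derivative p) x ℤ.+ h ℤ.* h ℤ.* k
taylor []      x h = 0ℤ , base h
  where
  base : ∀ h → 0ℤ ≡ 0ℤ ℤ.+ h ℤ.* 0ℤ ℤ.+ h ℤ.* h ℤ.* 0ℤ
  base = solve-∀
taylor (a ∷ p) x h with k , eq ← taylor p x h =
  P′ ℤ.+ x ℤ.* k ℤ.+ h ℤ.* k , (begin
    a ℤ.+ (x ℤ.+ h) ℤ.* eval p (x ℤ.+ h)
      ≡⟨ cong (λ y → a ℤ.+ (x ℤ.+ h) ℤ.* y) eq ⟩
    a ℤ.+ (x ℤ.+ h) ℤ.* (P ℤ.+ h ℤ.* P′ ℤ.+ h ℤ.* h ℤ.* k)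
      ≡⟨ rearrange a x h P P′ k ⟩
    a ℤ.+ x ℤ.* P ℤ.+ h ℤ.* (P ℤ.+ x ℤ.* P′) ℤ.+ h ℤ.* h ℤ.* (P′ ℤ.+ x ℤ.* k ℤ.+ h ℤ.* k)
      ≡⟨ cong (λ y → a ℤ.+ x ℤ.* P ℤ.+ h ℤ.* y ℤ.+ h ℤ.* h ℤ.* (P′ ℤ.+ x ℤ.* k ℤ.+ h ℤ.* k))
           (eval-derivative-∷ a p x) ⟨
    a ℤ.+ x ℤ.* P ℤ.+ h ℤ.* eval (derivative (a ∷ p)) x ℤ.+ h ℤ.* h ℤ.* (P′ ℤ.+ x ℤ.* k ℤ.+ h ℤ.* k) ∎)
  where
  open ≡-Reasoning
  P  = eval p x
  P′ = eval (derivative p) x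
  rearrange : ∀ a x h P P′ k →
    a ℤ.+ (x ℤ.+ h) ℤ.* (P ℤ.+ h ℤ.* P′ ℤ.+ h ℤ.* h ℤ.* k) ≡
    a ℤ.+ x ℤ.* P ℤ.+ h ℤ.* (P ℤ.+ x ℤ.* P′) ℤ.+ h ℤ.* h ℤ.* (P′ ℤ.+ x ℤ.* k ℤ.+ h ℤ.* k)
  rearrange = solve-∀

x≡y+[x-y] : ∀ x y → x ≡ y ℤ.+ (x ℤ.- y)
x≡y+[x-y] = solve-∀

eval-cong-∣ : ∀ p {m} x y → m ∣ x ℤ.- y → m ∣ eval p x ℤ.- eval p y
eval-cong-∣ p {m} x y m∣x-y with k , eq ← taylor p y (x ℤ.- y) =
  subst (m ∣_) (sym difference) (∣m⇒∣m*n _ m∣x-y)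
  where
  rearrange : ∀ P P′ h k → P ℤ.+ h ℤ.* P′ ℤ.+ h ℤ.* h ℤ.* k ℤ.- P ≡ h ℤ.* (P′ ℤ.+ h ℤ.* k)
  rearrange = solve-∀
  difference : eval p x ℤ.- eval p y ≡ (x ℤ.- y) ℤ.* (eval (derivative p) y ℤ.+ (x ℤ.- y) ℤ.* k)
  difference = trans
    (cong (λ z → z ℤ.- eval p y) (trans (cong (eval p) (x≡y+[x-y] x y)) eq))
    (rearrange (eval p y) (eval (derivative p) y) (x ℤ.- y) k)

-- Divisibility exactly once.

infix 4 _∥_
_∥_ : ℕ → ℤ → Set
q ∥ z = (+ q ∣ z) × ¬ (+ q ℤ.* + q ∣ z)

∥⇒≢0 : ∀ {q z} → q ∥ z → z ≢ 0ℤ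
∥⇒≢0 (_ , q²∤z) refl = q²∤z (divides 0ℤ refl)

-- Exact divisibility is visible modulo q² but not modulo q, so the congruence conditions on x are
-- imposed modulo squares.
∥-resp-mod : ∀ {q u v} → + q ℤ.* + q ∣ u ℤ.- v → q ∥ v → q ∥ u
∥-resp-mod {q} {u} {v} q²∣u-v (q∣v , q²∤v) =
    subst (+ q ∣_) (sym (x≡y+[x-y] u v)) (∣m∣n⇒∣m+n q∣v (∣-trans (divides (+ q) refl) q²∣u-v))
  , λ q²∣u → q²∤v (subst (+ q ℤ.* + q ∣_) (rearrange u v) (∣m∣n⇒∣m+n q²∣u (∣m⇒∣-m q²∣u-v)))
  where
  rearrange : ∀ u v → u ℤ.+ ℤ.- (u ℤ.- v) ≡ v
  rearrange = solve-∀

-- Modulo q², f(a + q) is f(a) + q f′(a), so q² cannot divide both f(a) and f(a + q).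
∥-at-simpleRoot : ∀ f {q a} → Prime q → + q ∣ eval f a → ¬ (+ q ∣ eval (derivative f) a) →
  ∃[ b ] q ∥ eval f b
∥-at-simpleRoot f {q} {a} q-prime q∣fa q∤f′a with + q ℤ.* + q ∣? eval f a
... | no  q²∤fa = a , q∣fa , q²∤fa
... | yes q²∣fa with k , eq ← taylor f a (+ q) = a ℤ.+ + q
  , subst (+ q ∣_) (sym eq) (∣m∣n⇒∣m+n (∣m∣n⇒∣m+n q∣fa (∣m⇒∣m*n _ (divides 1ℤ (sym (ℤ.*-identityˡ (+ q))))))
      (∣m⇒∣m*n k (divides (+ q) refl)))
  , λ q²∣ → q∤f′a (*-cancelˡ-∣ (+ q) {{ℤ-nonZero}} (∣m+n∣m⇒∣n
      (∣m+n∣m⇒∣n (subst (+ q ℤ.* + q ∣_) (trans eq (ℤ.+-comm (eval f a ℤ.+ + q ℤ.* eval (derivative f) a) _)) q²∣)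
        (∣m⇒∣m*n k (divides 1ℤ (sym (ℤ.*-identityˡ (+ q ℤ.* + q)))))) q²∣fa))
  where
  ℤ-nonZero : ℤ.NonZero (+ q)
  ℤ-nonZero = prime⇒nonZero q-prime

-- Chinese remaindering modulo squares of primes.

prime-∣-prime : ∀ {p q} → Prime p → Prime q → p ℕ∣.∣ q → p ≡ q
prime-∣-prime p-prime q-prime p∣q with prime⇒irreducible q-prime p∣q
... | inj₁ refl = contradiction p-prime ¬prime[1]
... | inj₂ p≡q  = p≡q

prime-coprime : ∀ {q M} → Prime q → ¬ (q ℕ∣.∣ M) → Coprime q M
prime-coprime q-prime q∤M (d∣q , d∣M) with prime⇒irreducible q-prime d∣q
... | inj₁ d≡1  = d≡1
... | inj₂ refl = contradiction d∣M q∤M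

inverse-mod : ∀ {q M} → Coprime q M → ∃[ u ] + q ∣ 1ℤ ℤ.- u ℤ.* + M
inverse-mod {q} {M} c with coprime-Bézout c
-- Bézout over the naturals has no signs: here 1 + yM = xq, so `M` has inverse -y; in the other case
-- 1 + xq = yM, and the inverse is y.
... | Bézout.+- x y eq = ℤ.- + y , divides (+ x) (begin
  1ℤ ℤ.- ℤ.- + y ℤ.* + M  ≡⟨ rearrange (+ y) (+ M) ⟩
  1ℤ ℤ.+ + y ℤ.* + M      ≡⟨ cong (λ z → 1ℤ ℤ.+ z) (ℤ.pos-* y M) ⟨
  1ℤ ℤ.+ + (y ℕ.* M)      ≡⟨ cong +_ eq ⟩
  + (x ℕ.* q)             ≡⟨ ℤ.pos-* x q ⟩
  + x ℤ.* + q             ∎)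
  where
  open ≡-Reasoning
  rearrange : ∀ y M → 1ℤ ℤ.- ℤ.- y ℤ.* M ≡ 1ℤ ℤ.+ y ℤ.* M
  rearrange = solve-∀
... | Bézout.-+ x y eq = + y , divides (ℤ.- + x) (begin
  1ℤ ℤ.- + y ℤ.* + M                ≡⟨ cong (λ z → 1ℤ ℤ.- z) (ℤ.pos-* y M) ⟨
  1ℤ ℤ.- + (y ℕ.* M)                ≡⟨ cong (λ z → 1ℤ ℤ.- + z) eq ⟨
  1ℤ ℤ.- (1ℤ ℤ.+ + (x ℕ.* q))       ≡⟨ cong (λ z → 1ℤ ℤ.- (1ℤ ℤ.+ z)) (ℤ.pos-* x q) ⟩
  1ℤ ℤ.- (1ℤ ℤ.+ + x ℤ.* + q)       ≡⟨ rearrange (+ x) (+ q) ⟩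
  ℤ.- + x ℤ.* + q                   ∎)
  where
  open ≡-Reasoning
  rearrange : ∀ x q → 1ℤ ℤ.- (1ℤ ℤ.+ x ℤ.* q) ≡ ℤ.- x ℤ.* q
  rearrange = solve-∀

-- If uM ≡ 1 (mod q) then M(2u - u²M) = 1 - (1 - uM)² ≡ 1 (mod q²).
chineseRemainder : ∀ {q M} → Coprime q M → ∀ a b →
  ∃[ x ] (+ M ∣ x ℤ.- a) × (+ q ℤ.* + q ∣ x ℤ.- b)
chineseRemainder {q} {M} c a b with u , divides w eq ← inverse-mod c =
    a ℤ.+ v u ℤ.* (b ℤ.- a) ℤ.* + M
  , divides (v u ℤ.* (b ℤ.- a)) (cancel a (v u ℤ.* (b ℤ.- a) ℤ.* + M))
  , divides (w ℤ.* w ℤ.* (a ℤ.- b)) (begin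
      a ℤ.+ v u ℤ.* (b ℤ.- a) ℤ.* + M ℤ.- b
        ≡⟨ complete u (+ M) a b ⟩
      (1ℤ ℤ.- u ℤ.* + M) ℤ.* (1ℤ ℤ.- u ℤ.* + M) ℤ.* (a ℤ.- b)
        ≡⟨ cong (λ z → z ℤ.* z ℤ.* (a ℤ.- b)) eq ⟩
      w ℤ.* + q ℤ.* (w ℤ.* + q) ℤ.* (a ℤ.- b)
        ≡⟨ rearrange w (+ q) (a ℤ.- b) ⟩
      w ℤ.* w ℤ.* (a ℤ.- b) ℤ.* (+ q ℤ.* + q) ∎)
  where
  open ≡-Reasoning
  v : ℤ → ℤ
  v u = u ℤ.+ u ℤ.- u ℤ.* u ℤ.* + M
  cancel : ∀ a z → a ℤ.+ z ℤ.- a ≡ z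
  cancel = solve-∀
  complete : ∀ u M a b → a ℤ.+ (u ℤ.+ u ℤ.- u ℤ.* u ℤ.* M) ℤ.* (b ℤ.- a) ℤ.* M ℤ.- b
    ≡ (1ℤ ℤ.- u ℤ.* M) ℤ.* (1ℤ ℤ.- u ℤ.* M) ℤ.* (a ℤ.- b)
  complete = solve-∀
  rearrange : ∀ w q z → w ℤ.* q ℤ.* (w ℤ.* q) ℤ.* z ≡ w ℤ.* w ℤ.* z ℤ.* (q ℤ.* q)
  rearrange = solve-∀

-- The invariant of the induction on `T`. Quantifying over the whole class of `a` modulo `M` keeps
-- earlier conditions when the class is refined; the bound on the prime divisors of `M` makes a new
-- prime coprime to it.
Residue : Poly → List ℕ → ℕ → ℤ → Set
Residue f T M a = (∀ p → Prime p → p ℕ∣.∣ M → p ∈ T) ×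
                  (∀ x → + M ∣ x ℤ.- a → All (λ q → q ∥ eval f x) T)

-- The new class lies in the old one and in that of `b` modulo q². Since `f` respects congruences,
-- its values there agree with f(b) modulo q².
residue-∷ : ∀ f {q T M a b} → Prime q → q ∥ eval f b → ¬ (q ∈ T) → Residue f T M a →
  ∃[ c ] Residue f (q ∷ T) (q ℕ.* q ℕ.* M) c
residue-∷ f {q} {T} {M} {a} {b} q-prime q∥fb q∉T (primes , values) =
  let c , M∣c-a , q²∣c-b = chineseRemainder (prime-coprime q-prime λ q∣M → q∉T (primes q q-prime q∣M)) a b
  in c , primes′ , values′ c M∣c-a q²∣c-b
  where
  primes′ : ∀ p → Prime p → p ℕ∣.∣ q ℕ.* q ℕ.* M → p ∈ q ∷ T
  primes′ p p-prime p∣q²M with euclidsLemma (q ℕ.* q) M p-prime p∣q²M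
  ... | inj₂ p∣M  = there (primes p p-prime p∣M)
  ... | inj₁ p∣q² with euclidsLemma q q p-prime p∣q²
  ...   | inj₁ p∣q = here (prime-∣-prime p-prime q-prime p∣q)
  ...   | inj₂ p∣q = here (prime-∣-prime p-prime q-prime p∣q)

  telescope : ∀ x y z → (x ℤ.- y) ℤ.+ (y ℤ.- z) ≡ x ℤ.- z
  telescope = solve-∀

  values′ : ∀ c → + M ∣ c ℤ.- a → + q ℤ.* + q ∣ c ℤ.- b →
    ∀ x → + (q ℕ.* q ℕ.* M) ∣ x ℤ.- c → All (λ q → q ∥ eval f x) (q ∷ T)
  values′ c M∣c-a q²∣c-b x q²M∣x-c =
      ∥-resp-mod (eval-cong-∣ f x b (via q²∣q²M q²∣c-b)) q∥fb
    ∷ values x (via M∣q²M M∣c-a)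
    where
    q²M≡ : + (q ℕ.* q ℕ.* M) ≡ + q ℤ.* + q ℤ.* + M
    q²M≡ = trans (ℤ.pos-* (q ℕ.* q) M) (cong (λ z → z ℤ.* + M) (ℤ.pos-* q q))
    M∣q²M : + M ∣ + (q ℕ.* q ℕ.* M)
    M∣q²M = divides (+ q ℤ.* + q) q²M≡
    q²∣q²M : + q ℤ.* + q ∣ + (q ℕ.* q ℕ.* M)
    q²∣q²M = divides (+ M) (trans q²M≡ (ℤ.*-comm (+ q ℤ.* + q) (+ M)))
    via : ∀ {m y} → m ∣ + (q ℕ.* q ℕ.* M) → m ∣ c ℤ.- y → m ∣ x ℤ.- y
    via {m} {y} m∣q²M m∣c-y =
      subst (m ∣_) (telescope x c y) (∣m∣n⇒∣m+n (∣-trans m∣q²M q²M∣x-c) m∣c-y)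

residue : ∀ f T → All (λ q → Prime q × ∃[ b ] q ∥ eval f b) T → ∃[ M ] ∃[ a ] Residue f T M a
residue f []      []  = 1 , 0ℤ
  , (λ p p-prime p∣1 → contradiction (subst Prime (ℕ∣.∣1⇒≡1 p∣1) p-prime) ¬prime[1])
  , λ _ _ → []
residue f (q ∷ T) ((q-prime , b , q∥fb) ∷ rest) with residue f T rest | q ∈? T
-- A list may repeat a prime. Such an entry keeps the old class, since coprimality to `M` is derived
-- from `q ∉ T`.
... | M , a , primes , values | yes q∈T = M , a , (λ p p-prime p∣M → there (primes p p-prime p∣M))
  , λ x M∣x-a → All.lookup (values x M∣x-a) q∈T ∷ values x M∣x-a
... | M , a , res | no q∉T = q ℕ.* q ℕ.* M , residue-∷ f {a = a} {b} q-prime q∥fb q∉T res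

-- Squarefree parts and nonzero values.

-- Splitting off a square m² with m ≥ 2 shrinks the absolute value. The search for m may stop at
-- `∣ z ∣`, as m divides the nonzero `z`; if it fails, `z` is squarefree.
squarefreePart : ∀ z → z ≢ 0ℤ → ∃[ d ] ∃[ s ] Squarefree d × z ≡ d ℤ.* (s ℤ.* s)
squarefreePart z = go z (<-wellFounded ∣ z ∣)
  where
  go : ∀ z → Acc ℕ._<_ ∣ z ∣ → z ≢ 0ℤ → ∃[ d ] ∃[ s ] Squarefree d × z ≡ d ℤ.* (s ℤ.* s)
  go z (acc rec) z≢0
    with ℕ.anyUpTo? (λ m → 2 ℕ.≤? m ×-dec (+ m ℤ.* + m ∣? z)) (suc ∣ z ∣)
  ... | yes (m , _ , 2≤m , divides w z≡wm²)
    = let d , s , sf , w≡ds² = go w (rec smaller) (λ { refl → z≢0 z≡wm² }) in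
      d , s ℤ.* + m , sf , trans z≡wm² (trans (cong (λ y → y ℤ.* (+ m ℤ.* + m)) w≡ds²) (rearrange d s (+ m)))
    where
    rearrange : ∀ d s m → d ℤ.* (s ℤ.* s) ℤ.* (m ℤ.* m) ≡ d ℤ.* (s ℤ.* m ℤ.* (s ℤ.* m))
    rearrange = solve-∀
    ∣z∣≡ : ∣ z ∣ ≡ ∣ w ∣ ℕ.* (m ℕ.* m)
    ∣z∣≡ = trans (cong ∣_∣ z≡wm²) (trans (ℤ.abs-* w (+ m ℤ.* + m)) (cong (∣ w ∣ ℕ.*_) (ℤ.abs-* (+ m) (+ m))))
    instance
      _ : ℕ.NonZero ∣ w ∣
      _ = ℕ.≢-nonZero λ ∣w∣≡0 → z≢0 (ℤ.∣i∣≡0⇒i≡0 (trans ∣z∣≡ (cong (ℕ._* (m ℕ.* m)) ∣w∣≡0)))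
    smaller : ∣ w ∣ ℕ.< ∣ z ∣
    smaller = subst (∣ w ∣ ℕ.<_) (sym ∣z∣≡) (ℕ.m<m*n ∣ w ∣ (m ℕ.* m) (ℕ.≤-trans (s≤s (s≤s z≤n)) (ℕ.*-mono-≤ 2≤m 2≤m)))
  ... | no none = z , 1ℤ , (z≢0 , unit) , sym (ℤ.*-identityʳ z)
    where
    instance
      _ : ℕ.NonZero ∣ z ∣
      _ = ℕ.≢-nonZero λ ∣z∣≡0 → z≢0 (ℤ.∣i∣≡0⇒i≡0 ∣z∣≡0)
    unit : ∀ m → m ℤ.* m ∣ z → ∣ m ∣ ≡ 1
    unit m m²∣z = abs≡1 ∣ m ∣ refl
      where
      abs≡1 : ∀ k → ∣ m ∣ ≡ k → k ≡ 1
      abs≡1 0 eq = contradiction (0∣⇒≡0 (subst (λ y → y ℤ.* y ∣ z) (ℤ.∣i∣≡0⇒i≡0 {m} eq) m²∣z)) z≢0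
      abs≡1 1 eq = refl
      abs≡1 k@(suc (suc _)) eq = contradiction
        (k , s≤s (ℕ∣.∣⇒≤ (ℕ∣.∣-trans (ℕ∣.m∣m*n k) k²∣z)) , s≤s (s≤s z≤n)
           , ∣ᵤ⇒∣ (subst (ℕ∣._∣ ∣ z ∣) (sym (ℤ.abs-* (+ k) (+ k))) k²∣z))
        none
        where
        k²∣z : k ℕ.* k ℕ∣.∣ ∣ z ∣
        k²∣z = subst (ℕ∣._∣ ∣ z ∣) (trans (ℤ.abs-* m m) (cong₂ ℕ._*_ eq eq)) (∣⇒∣ᵤ m²∣z)

-- Otherwise `q` divides s², hence `s`, and then q² divides `z`.
∥⇒∣squarefreePart : ∀ {q z d s} → Prime q → z ≡ d ℤ.* (s ℤ.* s) → q ∥ z → + q ∣ d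
∥⇒∣squarefreePart {q} {d = d} {s} q-prime refl (q∣z , q²∤z) with prime-∣-* q-prime d (s ℤ.* s) q∣z
... | inj₁ q∣d  = q∣d
... | inj₂ q∣s² = contradiction (∣n⇒∣m*n d (square q∣s)) q²∤z
  where
  q∣s : + q ∣ s
  q∣s with prime-∣-* q-prime s s q∣s²
  ... | inj₁ q∣s = q∣s
  ... | inj₂ q∣s = q∣s
  rearrange : ∀ k q → k ℤ.* q ℤ.* (k ℤ.* q) ≡ k ℤ.* k ℤ.* (q ℤ.* q)
  rearrange = solve-∀
  square : ∀ {x y} → x ∣ y → x ℤ.* x ∣ y ℤ.* y
  square {x} (divides k refl) = divides (k ℤ.* k) (rearrange k x)

-- When the constant term a is nonzero, the value at 2a is a times an odd number.
nonroot : ∀ p n → coeff p n ≢ 0ℤ → ∃[ x ] x ≢ 0ℤ × eval p x ≢ 0ℤ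
nonroot []      n       p≢0 = contradiction refl p≢0
nonroot (a ∷ p) n       p≢0 with a ℤ.≟ 0ℤ
nonroot (a ∷ p) n       p≢0 | no a≢0 = + 2 ℤ.* a , 2a≢0 , nonzero
  where
  2a≢0 : + 2 ℤ.* a ≢ 0ℤ
  2a≢0 eq with ℤ.i*j≡0⇒i≡0∨j≡0 (+ 2) {a} eq
  ... | inj₂ a≡0 = a≢0 a≡0
  factor : ∀ a y → a ℤ.+ + 2 ℤ.* a ℤ.* y ≡ a ℤ.* (1ℤ ℤ.+ + 2 ℤ.* y)
  factor = solve-∀
  odd : ∀ y → 1ℤ ℤ.+ + 2 ℤ.* y ≡ 0ℤ → + 2 ∣ 1ℤ
  odd y eq = divides (ℤ.- y) (trans (rearrange y) (trans (cong (λ z → z ℤ.+ ℤ.- y ℤ.* + 2) eq) (ℤ.+-identityˡ _)))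
    where
    rearrange : ∀ y → 1ℤ ≡ (1ℤ ℤ.+ + 2 ℤ.* y) ℤ.+ ℤ.- y ℤ.* + 2
    rearrange = solve-∀
  nonzero : a ℤ.+ + 2 ℤ.* a ℤ.* eval p (+ 2 ℤ.* a) ≢ 0ℤ
  nonzero eq with ℤ.i*j≡0⇒i≡0∨j≡0 a (trans (sym (factor a (eval p (+ 2 ℤ.* a)))) eq)
  ... | inj₁ a≡0 = a≢0 a≡0
  ... | inj₂ even = contradiction (ℕ∣.∣⇒≤ (∣⇒∣ᵤ (odd (eval p (+ 2 ℤ.* a)) even))) λ { (s≤s ()) }
nonroot (a ∷ p) zero    p≢0 | yes a≡0 = contradiction a≡0 p≢0
-- With constant term zero the value is x p(x), which is why the induction also keeps `x` nonzero.
nonroot (a ∷ p) (suc n) p≢0 | yes refl with x , x≢0 , px≢0 ← nonroot p n p≢0 =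
  x , x≢0 , nonzero
  where
  nonzero : 0ℤ ℤ.+ x ℤ.* eval p x ≢ 0ℤ
  nonzero eq with ℤ.i*j≡0⇒i≡0∨j≡0 x (trans (sym (ℤ.+-identityˡ _)) eq)
  ... | inj₁ x≡0  = x≢0 x≡0
  ... | inj₂ px≡0 = px≢0 px≡0

-- Integers inside the rationals.

-- `fromℤ` normalises a fraction and so does not compute on variables; its identities are
-- transferred from unnormalised fractions, where `mkℚᵘ i 0` has denominator 1.
toℚᵘ-fromℤ : ∀ i → ℚ.toℚᵘ (fromℤ i) ℚᵘ.≃ mkℚᵘ i 0
toℚᵘ-fromℤ i = ℚ.toℚᵘ-fromℚᵘ (mkℚᵘ i 0)

fromℤ-+ : ∀ i j → fromℤ (i ℤ.+ j) ≡ fromℤ i ℚ.+ fromℤ j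
fromℤ-+ i j = ℚ.toℚᵘ-injective (begin
  ℚ.toℚᵘ (fromℤ (i ℤ.+ j))                       ≈⟨ toℚᵘ-fromℤ (i ℤ.+ j) ⟩
  mkℚᵘ (i ℤ.+ j) 0                               ≈⟨ *≡* (rearrange i j) ⟩
  mkℚᵘ i 0 ℚᵘ.+ mkℚᵘ j 0                         ≈⟨ ℚᵘ.+-cong (toℚᵘ-fromℤ i) (toℚᵘ-fromℤ j) ⟨
  ℚ.toℚᵘ (fromℤ i) ℚᵘ.+ ℚ.toℚᵘ (fromℤ j)         ≈⟨ ℚ.toℚᵘ-homo-+ (fromℤ i) (fromℤ j) ⟨
  ℚ.toℚᵘ (fromℤ i ℚ.+ fromℤ j)                   ∎)
  where
  open SetoidReasoning ℚᵘ.≃-setoid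
  rearrange : ∀ i j → (i ℤ.+ j) ℤ.* 1ℤ ≡ (i ℤ.* 1ℤ ℤ.+ j ℤ.* 1ℤ) ℤ.* 1ℤ
  rearrange = solve-∀

fromℤ-* : ∀ i j → fromℤ (i ℤ.* j) ≡ fromℤ i ℚ.* fromℤ j
fromℤ-* i j = ℚ.toℚᵘ-injective (begin
  ℚ.toℚᵘ (fromℤ (i ℤ.* j))                       ≈⟨ toℚᵘ-fromℤ (i ℤ.* j) ⟩
  mkℚᵘ i 0 ℚᵘ.* mkℚᵘ j 0                         ≈⟨ ℚᵘ.*-cong (toℚᵘ-fromℤ i) (toℚᵘ-fromℤ j) ⟨
  ℚ.toℚᵘ (fromℤ i) ℚᵘ.* ℚ.toℚᵘ (fromℤ j)         ≈⟨ ℚ.toℚᵘ-homo-* (fromℤ i) (fromℤ j) ⟨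
  ℚ.toℚᵘ (fromℤ i ℚ.* fromℤ j)                   ∎)
  where open SetoidReasoning ℚᵘ.≃-setoid

fromℤ≡0 : ∀ {i} → fromℤ i ≡ 0ℚ → i ≡ 0ℤ
fromℤ≡0 {i} eq with *≡* i*1≡0 ← ℚ.fromℚᵘ-injective {mkℚᵘ i 0} {mkℚᵘ 0ℤ 0} eq = trans (sym (ℤ.*-identityʳ i)) i*1≡0

⟨fromℤ⟩ : ∀ f x → f ⟨ fromℤ x ⟩ ≡ fromℤ (eval f x)
⟨fromℤ⟩ []      x = refl
⟨fromℤ⟩ (a ∷ f) x = begin
  fromℤ a ℚ.+ fromℤ x ℚ.* (f ⟨ fromℤ x ⟩)      ≡⟨ cong (λ y → fromℤ a ℚ.+ fromℤ x ℚ.* y) (⟨fromℤ⟩ f x) ⟩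
  fromℤ a ℚ.+ fromℤ x ℚ.* fromℤ (eval f x)     ≡⟨ cong (fromℤ a ℚ.+_) (fromℤ-* x (eval f x)) ⟨
  fromℤ a ℚ.+ fromℤ (x ℤ.* eval f x)           ≡⟨ fromℤ-+ a (x ℤ.* eval f x) ⟨
  fromℤ (a ℤ.+ x ℤ.* eval f x)                 ∎
  where open ≡-Reasoning

squarefreePart-∈𝒮 : ∀ f x {d s} → eval f x ≢ 0ℤ → Squarefree d → eval f x ≡ d ℤ.* (s ℤ.* s) → 𝒮 f d
squarefreePart-∈𝒮 f x {d} {s} fx≢0 sf fx≡ds² =
  fromℤ x , (λ eq → fx≢0 (fromℤ≡0 (trans (sym (⟨fromℤ⟩ f x)) eq))) , sf , fromℤ s , (begin
    f ⟨ fromℤ x ⟩                       ≡⟨ ⟨fromℤ⟩ f x ⟩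
    fromℤ (eval f x)                    ≡⟨ cong fromℤ fx≡ds² ⟩
    fromℤ (d ℤ.* (s ℤ.* s))             ≡⟨ fromℤ-* d (s ℤ.* s) ⟩
    fromℤ d ℚ.* fromℤ (s ℤ.* s)         ≡⟨ cong (fromℤ d ℚ.*_) (fromℤ-* s s) ⟩
    fromℤ d ℚ.* (fromℤ s ℚ.* fromℤ s)   ∎)
  where open ≡-Reasoning

-- Values divisible exactly once by every prime of T, and the conclusion.

R⇒∥ : ∀ f {q} → ℤ[x].Nonconstant f → R f q → Prime q × ∃[ b ] q ∥ eval f b
R⇒∥ f {q} nc (good@(q-prime , _) , a , fa≈0) =
  q-prime , ∥-at-simpleRoot f q-prime q∣fa (root-simple f nc good q∣fa)
  where
  q∣fa : + q ∣ eval f a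
  q∣fa = subst (+ q ∣_) (eval-mod q f a) (≈0⇒∣ q fa≈0)

∥-value : ∀ f → ℤ[x].Nonconstant f → ∀ T → All (λ q → Prime q × ∃[ b ] q ∥ eval f b) T →
  ∃[ x ] eval f x ≢ 0ℤ × All (λ q → q ∥ eval f x) T
∥-value f (n , (lead≢0 , _) , _) [] [] with x , _ , fx≢0 ← nonroot f n lead≢0 = x , fx≢0 , []
∥-value f _ T@(_ ∷ _) local with M , a , _ , values ← residue f T local
  -- The representative `a` lies in its own class, and a single exact divisor already makes f(a)
  -- nonzero.
  with q∥fa ∷ rest ← values a (divides 0ℤ (ℤ.+-inverseʳ a)) = a , ∥⇒≢0 q∥fa , q∥fa ∷ rest

lemma2p2 : (f : ℤ[x].Poly) → ℤ[x].Nonconstant f → ℚ[x].Separable (toℚ[x] f) →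
    (T : List ℕ) → All (R f) T →
    ∃[ d ] 𝒮 f d × All (λ q → + q ∣ d) T
lemma2p2 f nc _ T T⊆R =
  let local            = All.map (R⇒∥ f nc) T⊆R
      x , fx≢0 , q∥fx  = ∥-value f nc T local
      d , s , sf , eq  = squarefreePart (eval f x) fx≢0
  in d , squarefreePart-∈𝒮 f x {d} {s} fx≢0 sf eq
   , All.zipWith (λ ((q-prime , _) , q∥fx) → ∥⇒∣squarefreePart {d = d} {s} q-prime eq q∥fx) (local , q∥fx)
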